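{- Let $k\ge1$. The logic $\mathbb{L}_k$ is algebraizable in the sense of Blok and Pigozzi with set of equivalence formulas $\Delta(p_1,p_2)=\{\delta(p_1,p_2)\}$ and set of defining equations $E(p_1)=\{p_1\approx p_1\leftrightarrow p_1\}$; that is, for all variables $p_1,\dots,p_{2n}$: (C1) $\models_k\delta(p_1,p_1)$; (C2) $\delta(p_1,p_2)\models_k\delta(p_2,p_1)$; (C3) $\delta(p_1,p_2),\delta(p_2,p_3)\models_k\delta(p_1,p_3)$; (C4) $\delta(p_1,p_{n+1}),\dots,\delta(p_n,p_{2n})\models_k\delta(\#(p_1,\dots,p_n),\#(p_{n+1},\dots,p_{2n}))$ for every $n$-ary connective $\#$ with $n\ge1$; (C5) $p_1\models_k\delta(p_1,p_1\leftrightarrow p_1)$; (C6) $\delta(p_1,p_1\leftrightarrow p_1)\models_k p_1$.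
   Context: A modal pseudocomplemented De Morgan algebra ($mpM$-algebra) is an algebra $\langle A,\wedge,\vee,\sim,{}^\ast,0,1\rangle$ such that $\langle A,\wedge,\vee,\sim,0,1\rangle$ is a De Morgan algebra (bounded distributive lattice with $\sim\sim x=x$, $\sim(x\vee y)=\sim x\wedge\sim y$), $x^\ast$ is the pseudocomplement of $x$, and $x\vee\sim x\le x\vee x^\ast$. A $\mathcal{C}_k$-algebra ($k\ge1$) is a pair $(A,t)$ with $A$ an $mpM$-algebra and $t$ an $mpM$-automorphism of $A$ with $t^k=\mathrm{id}$. $Fm$ is the set of formulas built from a denumerable set of variables with connectives $\wedge,\vee$ (binary), $\sim,{}^\ast,t$ (unary), $\top,\bot$ (constants); a valuation into $(A,t)$ is a homomorphism $v:Fm\to(A,t)$ (with $v(\top)=1$, $v(\bot)=0$). The $1$-assertional logic $\mathbb{L}_k=\langle Fm,\models_k\rangle$: $\Gamma\models_k\alpha$ iff for every $\mathcal{C}_k$-algebra $(A,t)$ and every valuation $v$, if $v(\gamma)=1$ for all $\gamma\in\Gamma$ then $v(\alpha)=1$. Define $x\to y=\sim\big((\sim(x\vee y))^\ast\wedge(x\vee y)\big)\vee\big((\sim(x\wedge y))^\ast\wedge(x\wedge y)\big)$, $x\leftrightarrow y=(x\to y)\wedge(\sim y\to\sim x)$, and $\delta(p,q)=\bigwedge_{i=0}^{k-1}(t^ip\leftrightarrow t^iq)$. -}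

module Defs where

open import Level using (Level; 0ℓ) renaming (suc to lsuc; _⊔_ to _⊔ˡ_)
open import Algebra.Core using (Op₁; Op₂)
import Algebra.Definitions as AlgDefs
open import Algebra.Lattice.Structures using (IsDistributiveLattice)
open import Algebra.Lattice.Bundles using (RawLattice)
open import Algebra.Lattice.Morphism.Structures using (IsLatticeIsomorphism)
open import Data.Nat.Base using (ℕ; zero; suc; NonZero)
open import Data.Nat.GeneralisedArithmetic using (fold)
open import Data.Fin.Base using (Fin)
open import Data.Product.Base using (∃; _×_; _,_)
open import Data.Vec.Base using (Vec; []; _∷_; map; lookup)
open import Relation.Binary.Core using (Rel)
open import Relation.Binary.Definitions using (Minimum; Maximum)
open import Relation.Unary using (Pred; _∈_; _∪_; ∅; ｛_｝)

-- Algebras are setoid-based, as in the standard library: _≈_ plays the role of equality.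

record MpMAlgebra (c ℓ : Level) : Set (lsuc (c ⊔ˡ ℓ)) where
  infix  9 _*
  infix  8 ∼_
  infixr 7 _∧_
  infixr 6 _∨_
  infix  4 _≈_ _≤_
  field
    Carrier : Set c
    _≈_     : Rel Carrier ℓ
    _∧_ _∨_ : Op₂ Carrier
    ∼_ _*   : Op₁ Carrier
    0# 1#   : Carrier

  _≤_ : Rel Carrier ℓ
  x ≤ y = x ∧ y ≈ x

  open AlgDefs _≈_

  field
    isDistributiveLattice : IsDistributiveLattice _≈_ _∨_ _∧_
    0#-minimum            : Minimum _≤_ 0#
    1#-maximum            : Maximum _≤_ 1#

    ∼-cong       : Congruent₁ ∼_
    ∼-involutive : Involutive ∼_
    ∼-∨          : ∀ x y → ∼ (x ∨ y) ≈ ∼ x ∧ ∼ y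

    -- x * is the greatest y such that x ∧ y ≈ 0#.
    *-cong       : Congruent₁ _*
    *-disjoint   : ∀ x → x ∧ x * ≈ 0#
    *-greatest   : ∀ x y → x ∧ y ≈ 0# → y ≤ x *

    modal        : ∀ x → x ∨ ∼ x ≤ x ∨ x *

  rawLattice : RawLattice c ℓ
  rawLattice = record { Carrier = Carrier ; _≈_ = _≈_ ; _∧_ = _∧_ ; _∨_ = _∨_ }

record IsMpMAutomorphism {c ℓ} (A : MpMAlgebra c ℓ) (t : Op₁ (MpMAlgebra.Carrier A)) : Set (c ⊔ˡ ℓ) where
  open MpMAlgebra A
  field
    isLatticeIsomorphism : IsLatticeIsomorphism rawLattice rawLattice t
    ∼-homo  : ∀ x → t (∼ x) ≈ ∼ t x
    *-homo  : ∀ x → t (x *) ≈ (t x) *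
    0#-homo : t 0# ≈ 0#
    1#-homo : t 1# ≈ 1#

record CAlgebra (k : ℕ) (c ℓ : Level) : Set (lsuc (c ⊔ˡ ℓ)) where
  field
    mpM : MpMAlgebra c ℓ
  open MpMAlgebra mpM public
  field
    t              : Op₁ Carrier
    isAutomorphism : IsMpMAutomorphism mpM t
    t^k≈id         : ∀ x → fold x t k ≈ x

data Connective : ℕ → Set where
  and or       : Connective 2
  neg star tee : Connective 1
  top bot      : Connective 0

data Fm : Set where
  var : ℕ → Fm
  app : ∀ {n} → Connective n → Vec Fm n → Fm

infix  9 _*ᶠ
infix  8 ∼ᶠ_
infixr 7 _∧ᶠ_
infixr 6 _∨ᶠ_
infix  5 _→ᶠ_ _↔ᶠ_

_∧ᶠ_ _∨ᶠ_ _→ᶠ_ _↔ᶠ_ : Op₂ Fm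
∼ᶠ_ _*ᶠ tᶠ : Op₁ Fm
⊤ᶠ : Fm

φ ∧ᶠ ψ = app and (φ ∷ ψ ∷ [])
φ ∨ᶠ ψ = app or (φ ∷ ψ ∷ [])
∼ᶠ φ   = app neg (φ ∷ [])
φ *ᶠ   = app star (φ ∷ [])
tᶠ φ   = app tee (φ ∷ [])
⊤ᶠ     = app top []

φ →ᶠ ψ = ∼ᶠ ((∼ᶠ (φ ∨ᶠ ψ)) *ᶠ ∧ᶠ (φ ∨ᶠ ψ)) ∨ᶠ ((∼ᶠ (φ ∧ᶠ ψ)) *ᶠ ∧ᶠ (φ ∧ᶠ ψ))
φ ↔ᶠ ψ = (φ →ᶠ ψ) ∧ᶠ (∼ᶠ ψ →ᶠ ∼ᶠ φ)

-- ⋀ k f is f 0 ∧ᶠ … ∧ᶠ f (k - 1); the value at k = 0 is only a convention.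
⋀ : ℕ → (ℕ → Fm) → Fm
⋀ zero          f = ⊤ᶠ
⋀ (suc zero)    f = f 0
⋀ (suc (suc n)) f = ⋀ (suc n) f ∧ᶠ f (suc n)

δ : ℕ → Op₂ Fm
δ k φ ψ = ⋀ k (λ i → fold φ tᶠ i ↔ᶠ fold ψ tᶠ i)

module _ {k : ℕ} {c ℓ : Level} (A : CAlgebra k c ℓ) where
  open CAlgebra A

  ⟦_⟧ : ∀ {n} → Connective n → Vec Carrier n → Carrier
  ⟦ and  ⟧ (x ∷ y ∷ []) = x ∧ y
  ⟦ or   ⟧ (x ∷ y ∷ []) = x ∨ y
  ⟦ neg  ⟧ (x ∷ [])     = ∼ x
  ⟦ star ⟧ (x ∷ [])     = x *
  ⟦ tee  ⟧ (x ∷ [])     = t x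
  ⟦ top  ⟧ []           = 1#
  ⟦ bot  ⟧ []           = 0#

  IsValuation : (Fm → Carrier) → Set ℓ
  IsValuation v = ∀ {n} (# : Connective n) (φs : Vec Fm n) → v (app # φs) ≈ ⟦ # ⟧ (map v φs)

Consequence : (r : Level) → Set (lsuc r)
Consequence r = Pred Fm 0ℓ → Fm → Set r

-- The logic 𝕃_k, over all algebras whose carrier and equality live at levels c and ℓ.
𝕃 : (k : ℕ) (c ℓ : Level) → Consequence (lsuc (c ⊔ˡ ℓ))
𝕃 k c ℓ Γ α = (A : CAlgebra k c ℓ) → let open CAlgebra A in
              (v : Fm → Carrier) → IsValuation A v →
              (∀ γ → γ ∈ Γ → v γ ≈ 1#) → v α ≈ 1#

-- Algebraizability in the sense of Blok and Pigozzi, via the syntactic conditions (C1)–(C6).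
-- The two-variable formula set Δ and the one-variable equation set E are given by their
-- substitution instances; an equation ε ≈ η is the pair (ε , η).
record Algebraizable {r} (_⊢_ : Consequence r)
                     (Δ : Fm → Fm → Pred Fm 0ℓ) (E : Fm → Pred (Fm × Fm) 0ℓ) : Set r where
  infix 3 _⊢ˢ_
  _⊢ˢ_ : Pred Fm 0ℓ → Pred Fm 0ℓ → Set r
  Γ ⊢ˢ Φ = ∀ φ → φ ∈ Φ → Γ ⊢ φ

  -- The union of the sets Δ(ε, η) with ε ≈ η in E(φ).
  ΔE : Fm → Pred Fm 0ℓ
  ΔE φ χ = ∃ λ ((ε , η) : Fm × Fm) → (ε , η) ∈ E φ × χ ∈ Δ ε η

  field
    C1 : ∀ p → ∅ ⊢ˢ Δ (var p) (var p)
    C2 : ∀ p q → Δ (var p) (var q) ⊢ˢ Δ (var q) (var p)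
    C3 : ∀ p q s → Δ (var p) (var q) ∪ Δ (var q) (var s) ⊢ˢ Δ (var p) (var s)
    C4 : ∀ {n} .{{_ : NonZero n}} (# : Connective n) (ps qs : Vec ℕ n) →
         (λ χ → ∃ λ (i : Fin n) → χ ∈ Δ (var (lookup ps i)) (var (lookup qs i)))
           ⊢ˢ Δ (app # (map var ps)) (app # (map var qs))
    C5 : ∀ p → ｛ var p ｝ ⊢ˢ ΔE (var p)
    C6 : ∀ p → ΔE (var p) ⊢ var p

Δδ : ℕ → Fm → Fm → Pred Fm 0ℓ
Δδ k φ ψ = ｛ δ k φ ψ ｝

E↔ : Fm → Pred (Fm × Fm) 0ℓ
E↔ φ = ｛ (φ , (φ ↔ᶠ φ)) ｝

{-# OPTIONS --safe #-}
-- Put □ z = (∼ z)* ∧ z, so that x → y = ∼ □ (x ∨ y) ∨ □ (x ∧ y).  The modal law makes □ z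
-- complemented by ∼ □ z, hence x ↔ x = 1.  Conversely, with u = x ∧ y and w = x ∨ y, the equation
-- x ↔ y = 1 gives □ w ≤ u and □ (∼ u) ≤ ∼ w, and these two inequalities force w ≤ u, i.e. x = y.
-- Thus δ(φ, ψ) takes the value 1 exactly when φ and ψ take the same value, and (C1)–(C6) become
-- statements about equality.
module Submission where

open import Defs
open import Level using (Level)
open import Data.Nat.Base using (ℕ; zero; suc; NonZero)
open import Algebra.Core using (Op₁; Op₂)
open import Algebra.Lattice.Bundles using (Lattice)
open import Algebra.Lattice.Morphism.Structures using (IsLatticeIsomorphism)
open import Algebra.Lattice.Structures using (IsDistributiveLattice)
import Algebra.Lattice.Properties.Lattice as LatticeProperties
open import Data.Nat.GeneralisedArithmetic using (fold)
open import Data.Product.Base using (_,_)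
open import Data.Sum.Base using (inj₁; inj₂)
open import Data.Vec.Relation.Binary.Pointwise.Inductive using (Pointwise; []; _∷_; map⁺)
open import Data.Vec.Relation.Binary.Pointwise.Extensional using (ext; extensional⇒inductive)
import Relation.Binary.Lattice.Bundles as Order
import Relation.Binary.Reasoning.PartialOrder as ≤-Reasoning
open import Relation.Binary.PropositionalEquality.Core using (refl)

module MpMProperties {c ℓ} (A : MpMAlgebra c ℓ) where
  open MpMAlgebra A using (Carrier; _≈_; _∧_; _∨_; ∼_; _*; 0#; 1#; isDistributiveLattice;
    0#-minimum; 1#-maximum; ∼-cong; ∼-involutive; ∼-∨; *-cong; *-disjoint; modal)
  open IsDistributiveLattice isDistributiveLattice public
    using (isLattice; sym; trans; ∧-cong; ∨-cong; ∧-comm; ∨-comm; ∧-distribˡ-∨)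
    renaming (refl to ≈-refl)

  lattice : Lattice c ℓ
  lattice = record { isLattice = isLattice }

  -- The library's order is x ≈ x ∧ y, the mirror image of MpMAlgebra._≤_.
  open Order.Lattice (LatticeProperties.∨-∧-orderTheoreticLattice lattice) public
    using (_≤_; poset; antisym; x∧y≤x; x∧y≤y; ∧-greatest; x≤x∨y; y≤x∨y; ∨-least)
    renaming (refl to ≤-refl; reflexive to ≤-reflexive; trans to ≤-trans)
  open ≤-Reasoning poset

  -- Order, De Morgan duality and the modal law

  0≤ : ∀ x → 0# ≤ x
  0≤ x = sym (0#-minimum x)

  ≤1 : ∀ x → x ≤ 1#
  ≤1 x = sym (1#-maximum x)

  ∧-monoˡ : ∀ {x y} z → x ≤ y → x ∧ z ≤ y ∧ z
  ∧-monoˡ z x≤y = ∧-greatest (≤-trans (x∧y≤x _ z) x≤y) (x∧y≤y _ z)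

  -- Case analysis along a join that covers `x`; distributivity enters the proof here.
  ≤-split : ∀ {x y z w} → x ≤ y ∨ z → x ∧ y ≤ w → x ∧ z ≤ w → x ≤ w
  ≤-split {x} {y} {z} {w} x≤y∨z xy≤w xz≤w = begin
    x                   ≤⟨ ∧-greatest ≤-refl x≤y∨z ⟩
    x ∧ (y ∨ z)         ≈⟨ ∧-distribˡ-∨ x y z ⟩
    (x ∧ y) ∨ (x ∧ z)   ≤⟨ ∨-least xy≤w xz≤w ⟩
    w                   ∎

  ∧≈1ˡ : ∀ {x y} → x ∧ y ≈ 1# → x ≈ 1#
  ∧≈1ˡ {x} {y} e = antisym (≤1 x) (≤-trans (≤-reflexive (sym e)) (x∧y≤x x y))

  ∧≈1ʳ : ∀ {x y} → x ∧ y ≈ 1# → y ≈ 1#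
  ∧≈1ʳ {x} {y} e = ∧≈1ˡ (trans (∧-comm y x) e)

  ∧≈1 : ∀ {x y} → x ≈ 1# → y ≈ 1# → x ∧ y ≈ 1#
  ∧≈1 x≈1 y≈1 = antisym (≤1 _) (∧-greatest (≤-reflexive (sym x≈1)) (≤-reflexive (sym y≈1)))

  ∼-∧ : ∀ x y → ∼ (x ∧ y) ≈ ∼ x ∨ ∼ y
  ∼-∧ x y = begin-equality
    ∼ (x ∧ y)           ≈⟨ ∼-cong (∧-cong (∼-involutive x) (∼-involutive y)) ⟨
    ∼ (∼ ∼ x ∧ ∼ ∼ y)   ≈⟨ ∼-cong (∼-∨ (∼ x) (∼ y)) ⟨
    ∼ ∼ (∼ x ∨ ∼ y)     ≈⟨ ∼-involutive _ ⟩
    ∼ x ∨ ∼ y           ∎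

  ∼-anti : ∀ {x y} → x ≤ y → ∼ y ≤ ∼ x
  ∼-anti {x} {y} x≤y = begin
    ∼ y         ≤⟨ y≤x∨y (∼ x) (∼ y) ⟩
    ∼ x ∨ ∼ y   ≈⟨ ∼-∧ x y ⟨
    -- The order unfolds to `x ≈ x ∧ y`, so `x≤y` itself serves as the equation.
    ∼ (x ∧ y)   ≈⟨ ∼-cong x≤y ⟨
    ∼ x         ∎

  ∼0≈1 : ∼ 0# ≈ 1#
  ∼0≈1 = antisym (≤1 _) (≤-trans (≤-reflexive (sym (∼-involutive 1#))) (∼-anti (0≤ (∼ 1#))))

  ∼x≤x∨x* : ∀ x → ∼ x ≤ x ∨ x *
  ∼x≤x∨x* x = ≤-trans (y≤x∨y x (∼ x)) (sym (modal x))

  -- De Morgan dual of the modal law.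
  ∼x∧∼x*≤x : ∀ x → ∼ x ∧ ∼ (x *) ≤ x
  ∼x∧∼x*≤x x = begin
    ∼ x ∧ ∼ (x *)   ≈⟨ ∼-∨ x (x *) ⟨
    ∼ (x ∨ x *)     ≤⟨ ∼-anti (∼x≤x∨x* x) ⟩
    ∼ ∼ x           ≈⟨ ∼-involutive x ⟩
    x               ∎

  x∧x*≤ : ∀ x y → x ∧ x * ≤ y
  x∧x*≤ x y = ≤-trans (≤-reflexive (*-disjoint x)) (0≤ y)

  -- Complementedness of `□ x`

  infix 8 □_
  □_ : Op₁ Carrier
  □ x = (∼ x) * ∧ x

  □-cong : ∀ {x y} → x ≈ y → □ x ≈ □ y
  □-cong x≈y = ∧-cong (*-cong (∼-cong x≈y)) x≈y

  □x≤x : ∀ x → □ x ≤ x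
  □x≤x x = x∧y≤y _ x

  -- By De Morgan, `∼ □ x` is the join of `∼ ((∼ x) *)` and `∼ x`. Within `□ x` both parts lie below
  -- `∼ x`, the first by the dual modal law at `∼ x`; but `□ x` also lies below `(∼ x) *`, which is
  -- disjoint from `∼ x`.
  □x∧∼□x≤0 : ∀ x → □ x ∧ ∼ □ x ≤ 0#
  □x∧∼□x≤0 x = ≤-split {z = ∼ x}
    (≤-trans (x∧y≤y _ _) (≤-reflexive (∼-∧ _ x)))
    (begin
      (□ x ∧ ∼ □ x) ∧ ∼ ((∼ x) *)   ≤⟨ ∧-greatest inside above ⟩
      ∼ x ∧ (∼ x) *                 ≤⟨ x∧x*≤ (∼ x) 0# ⟩
      0#                            ∎)
    (begin
      (□ x ∧ ∼ □ x) ∧ ∼ x   ≤⟨ ∧-greatest (x∧y≤y _ _) above ⟩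
      ∼ x ∧ (∼ x) *         ≤⟨ x∧x*≤ (∼ x) 0# ⟩
      0#                    ∎)
    where
    above : ∀ {y} → (□ x ∧ ∼ □ x) ∧ y ≤ (∼ x) *
    above = ≤-trans (x∧y≤x _ _) (≤-trans (x∧y≤x _ _) (x∧y≤x _ x))
    inside : (□ x ∧ ∼ □ x) ∧ ∼ ((∼ x) *) ≤ ∼ x
    inside = begin
      (□ x ∧ ∼ □ x) ∧ ∼ ((∼ x) *)   ≤⟨ ∧-monoˡ _ (≤-trans (x∧y≤x _ _) (□x≤x x)) ⟩
      x ∧ ∼ ((∼ x) *)               ≈⟨ ∧-cong (∼-involutive x) ≈-refl ⟨
      ∼ ∼ x ∧ ∼ ((∼ x) *)           ≤⟨ ∼x∧∼x*≤x (∼ x) ⟩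
      ∼ x                           ∎

  ∼□x∨□x≈1 : ∀ x → ∼ □ x ∨ □ x ≈ 1#
  ∼□x∨□x≈1 x = begin-equality
    ∼ □ x ∨ □ x       ≈⟨ ∨-cong ≈-refl (∼-involutive _) ⟨
    ∼ □ x ∨ ∼ ∼ □ x   ≈⟨ ∼-∧ (□ x) (∼ □ x) ⟨
    ∼ (□ x ∧ ∼ □ x)   ≈⟨ ∼-cong (antisym (□x∧∼□x≤0 x) (0≤ _)) ⟩
    ∼ 0#              ≈⟨ ∼0≈1 ⟩
    1#                ∎

  -- Split `□ x` along the given cover of `1#`: the part inside `∼ □ x` vanishes, so only the part
  -- inside `y` remains.
  ∼□x∨y≈1⇒□x≤y : ∀ {x y} → ∼ □ x ∨ y ≈ 1# → □ x ≤ y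
  ∼□x∨y≈1⇒□x≤y {x} {y} e = ≤-split
    (≤-trans (≤1 _) (≤-reflexive (sym e)))
    (≤-trans (□x∧∼□x≤0 x) (0≤ y))
    (x∧y≤y _ y)

  -- Dualizing the last hypothesis covers `w` by `∼ (u *)` and `u`, so only the part of `w` inside
  -- `∼ (u *)` has to be bounded.
  □-determines : ∀ {u w} → u ≤ w → □ w ≤ u → □ ∼ u ≤ ∼ w → w ≤ u
  □-determines {u} {w} u≤w □w≤u □∼u≤∼w = ≤-split w≤∼u*∨u w∧∼u*≤u (x∧y≤y w u)
    where
    w≤∼u*∨u : w ≤ ∼ (u *) ∨ u
    w≤∼u*∨u = begin
      w                       ≈⟨ ∼-involutive w ⟨
      ∼ ∼ w                   ≤⟨ ∼-anti □∼u≤∼w ⟩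
      ∼ ((∼ ∼ u) * ∧ ∼ u)     ≈⟨ ∼-∧ _ _ ⟩
      ∼ ((∼ ∼ u) *) ∨ ∼ ∼ u   ≈⟨ ∨-cong (∼-cong (*-cong (∼-involutive u))) (∼-involutive u) ⟩
      ∼ (u *) ∨ u             ∎

    w∧∼u*≤u : w ∧ ∼ (u *) ≤ u
    -- The modal law at `∼ w` gives the cover. On `∼ w`, which is below `∼ u`, the dual modal law at
    -- `u` applies; on `(∼ w) *` the element falls under `□ w`.
    w∧∼u*≤u = ≤-split {y = ∼ w} {z = (∼ w) *}
      (begin
        w ∧ ∼ (u *)     ≤⟨ x∧y≤x w _ ⟩
        w               ≈⟨ ∼-involutive w ⟨
        ∼ ∼ w           ≤⟨ ∼x≤x∨x* (∼ w) ⟩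
        ∼ w ∨ (∼ w) *   ∎)
      (begin
        (w ∧ ∼ (u *)) ∧ ∼ w   ≤⟨ ∧-greatest (≤-trans (x∧y≤y _ _) (∼-anti u≤w))
                                            (≤-trans (x∧y≤x _ _) (x∧y≤y _ _)) ⟩
        ∼ u ∧ ∼ (u *)   ≤⟨ ∼x∧∼x*≤x u ⟩
        u               ∎)
      (begin
        (w ∧ ∼ (u *)) ∧ (∼ w) *   ≤⟨ ∧-greatest (x∧y≤y _ _) (≤-trans (x∧y≤x _ _) (x∧y≤x w _)) ⟩
        □ w                       ≤⟨ □w≤u ⟩
        u                         ∎)

  -- Equivalence with value 1 is equality

  infix 5 _⇒_ _⇔_
  _⇒_ _⇔_ : Op₂ Carrier
  x ⇒ y = ∼ □ (x ∨ y) ∨ □ (x ∧ y)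
  x ⇔ y = (x ⇒ y) ∧ (∼ y ⇒ ∼ x)

  -- Meet and join of equal elements coincide, which turns `x ⇒ y` into an instance of excluded
  -- middle for `□`.
  ⇒-refl : ∀ {x y} → x ≈ y → (x ⇒ y) ≈ 1#
  ⇒-refl {x} {y} x≈y = trans (∨-cong ≈-refl (□-cong x∧y≈x∨y)) (∼□x∨□x≈1 (x ∨ y))
    where
    x∧y≈x∨y : x ∧ y ≈ x ∨ y
    x∧y≈x∨y = antisym
      (≤-trans (x∧y≤x x y) (x≤x∨y x y))
      (∨-least (∧-greatest ≤-refl (≤-reflexive x≈y)) (∧-greatest (≤-reflexive (sym x≈y)) ≤-refl))

  ⇔-refl : ∀ {x y} → x ≈ y → (x ⇔ y) ≈ 1#
  ⇔-refl x≈y = ∧≈1 (⇒-refl x≈y) (⇒-refl (∼-cong (sym x≈y)))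

  ⇒≈1⇒□∨≤∧ : ∀ {x y} → (x ⇒ y) ≈ 1# → □ (x ∨ y) ≤ x ∧ y
  ⇒≈1⇒□∨≤∧ e = ≤-trans (∼□x∨y≈1⇒□x≤y e) (□x≤x _)

  ⇔≈1⇒≈ : ∀ {x y} → (x ⇔ y) ≈ 1# → x ≈ y
  ⇔≈1⇒≈ {x} {y} e = antisym
    (≤-trans (x≤x∨y x y) (≤-trans x∨y≤x∧y (x∧y≤y x y)))
    (≤-trans (y≤x∨y x y) (≤-trans x∨y≤x∧y (x∧y≤x x y)))
    where
    x∨y≤x∧y : x ∨ y ≤ x ∧ y
    -- The conjunct `∼ y ⇒ ∼ x` supplies the second inequality, once De Morgan rewrites its join and
    -- meet as `∼ (x ∧ y)` and `∼ (x ∨ y)`.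
    x∨y≤x∧y = □-determines (≤-trans (x∧y≤x x y) (x≤x∨y x y)) (⇒≈1⇒□∨≤∧ (∧≈1ˡ e)) (begin
      □ ∼ (x ∧ y)     ≈⟨ □-cong (trans (∼-∧ x y) (∨-comm _ _)) ⟩
      □ (∼ y ∨ ∼ x)   ≤⟨ ⇒≈1⇒□∨≤∧ (∧≈1ʳ e) ⟩
      ∼ y ∧ ∼ x       ≈⟨ trans (∼-∨ x y) (∧-comm _ _) ⟨
      ∼ (x ∨ y)       ∎)

-- Values of formulas under a valuation

module ValuationProperties {k c ℓ} (A : CAlgebra k c ℓ) (v : Fm → CAlgebra.Carrier A)
                           (val : IsValuation A v) where
  open CAlgebra A using (_≈_; 1#; mpM; isAutomorphism; ∼-cong; *-cong)
  open MpMProperties mpM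
  open IsLatticeIsomorphism (IsMpMAutomorphism.isLatticeIsomorphism isAutomorphism)
    using () renaming (⟦⟧-cong to t-cong)

  ⟦⟧-cong : ∀ {n} (# : Connective n) {xs ys} → Pointwise _≈_ xs ys → ⟦_⟧ A # xs ≈ ⟦_⟧ A # ys
  ⟦⟧-cong and  (p ∷ q ∷ []) = ∧-cong p q
  ⟦⟧-cong or   (p ∷ q ∷ []) = ∨-cong p q
  ⟦⟧-cong neg  (p ∷ [])     = ∼-cong p
  ⟦⟧-cong star (p ∷ [])     = *-cong p
  ⟦⟧-cong tee  (p ∷ [])     = t-cong p
  ⟦⟧-cong top  []           = ≈-refl
  ⟦⟧-cong bot  []           = ≈-refl

  v-app-cong : ∀ {n} (# : Connective n) {φs ψs} →
               Pointwise (λ φ ψ → v φ ≈ v ψ) φs ψs → v (app # φs) ≈ v (app # ψs)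
  v-app-cong # ps = trans (val # _) (trans (⟦⟧-cong # (map⁺ (λ p → p) ps)) (sym (val # _)))

  v-□ : ∀ {φ x} → v φ ≈ x → v ((∼ᶠ φ) *ᶠ ∧ᶠ φ) ≈ □ x
  v-□ p = trans (val and _)
    (∧-cong (trans (val star _) (*-cong (trans (val neg _) (∼-cong p)))) p)

  v-⇒ : ∀ {φ ψ x y} → v φ ≈ x → v ψ ≈ y → v (φ →ᶠ ψ) ≈ (x ⇒ y)
  v-⇒ p q = trans (val or _) (∨-cong
    (trans (val neg _) (∼-cong (v-□ (trans (val or _) (∨-cong p q)))))
    (v-□ (trans (val and _) (∧-cong p q))))

  v-⇔ : ∀ φ ψ → v (φ ↔ᶠ ψ) ≈ (v φ ⇔ v ψ)
  v-⇔ φ ψ = trans (val and _) (∧-cong (v-⇒ ≈-refl ≈-refl) (v-⇒ (val neg _) (val neg _)))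

  ↔-intro : ∀ {φ ψ} → v φ ≈ v ψ → v (φ ↔ᶠ ψ) ≈ 1#
  ↔-intro p = trans (v-⇔ _ _) (⇔-refl p)

  ↔-elim : ∀ {φ ψ} → v (φ ↔ᶠ ψ) ≈ 1# → v φ ≈ v ψ
  ↔-elim p = ⇔≈1⇒≈ (trans (sym (v-⇔ _ _)) p)

  ⋀-intro : ∀ n {f} → (∀ i → v (f i) ≈ 1#) → v (⋀ n f) ≈ 1#
  ⋀-intro zero          p = val top _
  ⋀-intro (suc zero)    p = p 0
  ⋀-intro (suc (suc n)) p = trans (val and _) (∧≈1 (⋀-intro (suc n) p) (p (suc n)))

  -- The conjunction nests to the left, so stripping last conjuncts ends at `f 0`.
  ⋀-elim₀ : ∀ n {f} → v (⋀ (suc n) f) ≈ 1# → v (f 0) ≈ 1#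
  ⋀-elim₀ zero    p = p
  ⋀-elim₀ (suc n) p = ⋀-elim₀ n (∧≈1ˡ (trans (sym (val and _)) p))

  δ-intro : ∀ n {φ ψ} → v φ ≈ v ψ → v (δ n φ ψ) ≈ 1#
  δ-intro n {φ} {ψ} p = ⋀-intro n (λ i → ↔-intro (tⁱ i))
    where
    tⁱ : ∀ i → v (fold φ tᶠ i) ≈ v (fold ψ tᶠ i)
    tⁱ zero    = p
    tⁱ (suc i) = v-app-cong tee (tⁱ i ∷ [])

  -- The conjunct at index 0 is `φ ↔ᶠ ψ` itself; `NonZero n` guarantees that it is present.
  δ-elim : ∀ n .{{_ : NonZero n}} {φ ψ} → v (δ n φ ψ) ≈ 1# → v φ ≈ v ψ
  δ-elim (suc n) p = ↔-elim (⋀-elim₀ n p)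

theorem7p6 : ∀ (c ℓ : Level) (k : ℕ) .{{_ : NonZero k}} → Algebraizable (𝕃 k c ℓ) (Δδ k) E↔
theorem7p6 c ℓ k = record
  { C1 = λ { p _ refl A v val _ → let open Facts A v val in δ-intro k ≈-refl }
  ; C2 = λ { p q _ refl A v val h → let open Facts A v val in
             δ-intro k (sym (δ-elim k (h _ refl))) }
  ; C3 = λ { p q s _ refl A v val h → let open Facts A v val in
             δ-intro k (trans (δ-elim k (h _ (inj₁ refl))) (δ-elim k (h _ (inj₂ refl)))) }
  ; C4 = λ { # ps qs _ refl A v val h → let open Facts A v val in
             -- The premise with index `i` equates the values at position `i`; `map⁺` carries this
             -- from the variable indices to the vectors of variables.
             δ-intro k (v-app-cong # (map⁺ (λ p → p)
               (extensional⇒inductive (ext λ i → δ-elim k (h _ (i , refl)))))) }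
  -- In (C5) and (C6), `p ↔ᶠ p` always has value `1#`, so the defining equation says that `p` has
  -- value `1#`.
  ; C5 = λ { p _ (_ , refl , refl) A v val h → let open Facts A v val in
             δ-intro k (trans (h _ refl) (sym (↔-intro ≈-refl))) }
  ; C6 = λ { p A v val h → let open Facts A v val in
             trans (δ-elim k (h _ (_ , refl , refl))) (↔-intro ≈-refl) }
  }
  where
  module Facts (A : CAlgebra k c ℓ) (v : Fm → CAlgebra.Carrier A) (val : IsValuation A v) where
    open MpMProperties (CAlgebra.mpM A) public using (≈-refl; sym; trans)
    open ValuationProperties A v val public
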